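{- Let $\mathbf{u}$ be an infinite word over a finite alphabet $\mathcal{A}$ with $\#\mathcal{A}=k$, whose language $\mathcal{L}(\mathbf{u})$ is closed under reversal, and assume that the factor complexity of $\mathbf{u}$ satisfies $\mathcal{C}(n)=(k-1)n+1$ for all $n\in\mathbb{N}$. Then every palindrome in $\mathcal{L}(\mathbf{u})$ has a unique palindromic extension in $\mathbf{u}$ if and only if all bispecial factors of $\mathbf{u}$ are ordinary.
   Context: An infinite word over a finite alphabet $\mathcal{A}$ is a one-sided infinite sequence $\mathbf{u}=u_0u_1u_2\ldots$ of letters of $\mathcal{A}$ in which every letter of $\mathcal{A}$ occurs. Its language $\mathcal{L}(\mathbf{u})$ is the set of all its finite factors (contiguous subwords), including the empty word; $\mathcal{C}(n)$ is the number of distinct factors of length $n$; $\mathbb{N}$ includes $0$. The reversal of $w=w_0\cdots w_{n-1}$ is $\overline{w}=w_{n-1}\cdots w_0$; $w$ is a palindrome if $w=\overline{w}$ (the empty word is a palindrome). $\mathcal{L}(\mathbf{u})$ is closed under reversal if $w\in\mathcal{L}(\mathbf{u})$ implies $\overline{w}\in\mathcal{L}(\mathbf{u})$. For a palindrome $w\in\mathcal{L}(\mathbf{u})$, a palindromic extension of $w$ is a word $awa\in\mathcal{L}(\mathbf{u})$ with $a\in\mathcal{A}$. For $w\in\mathcal{L}(\mathbf{u})$: $\mathrm{Lext}(w)=\{a\in\mathcal{A}: aw\in\mathcal{L}(\mathbf{u})\}$, $\mathrm{Rext}(w)=\{a\in\mathcal{A}: wa\in\mathcal{L}(\mathbf{u})\}$,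 $\mathrm{Bext}(w)=\{awb\in\mathcal{L}(\mathbf{u}): a,b\in\mathcal{A}\}$. A factor $w$ is bispecial if $\#\mathrm{Lext}(w)\ge 2$ and $\#\mathrm{Rext}(w)\ge 2$. The bilateral order of $w$ is $\mathrm{b}(w)=\#\mathrm{Bext}(w)-\#\mathrm{Rext}(w)-\#\mathrm{Lext}(w)+1$; a bispecial factor $w$ is ordinary if $\mathrm{b}(w)=0$. -}

module Defs where

open import Data.Integer.Base as ℤ using (ℤ; +_; 0ℤ; 1ℤ)
open import Data.List.Base using (List; _∷_; _∷ʳ_; length; reverse; applyUpTo)
open import Data.List.Membership.Propositional using (_∈_)
open import Data.List.Relation.Unary.Unique.Propositional using (Unique)
open import Data.Nat.Base using (ℕ; _+_; _≤_)
open import Data.Product using (_×_; ∃-syntax; ∃!)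
open import Function.Bundles using (_⇔_)
open import Relation.Binary.PropositionalEquality using (_≡_)

-- HasSize P n: a duplicate-free list of length n enumerates exactly the elements
-- satisfying P. It is a relation because the sets counted below (factors of an
-- arbitrary sequence) are not decidable in general; n is determined by P.
HasSize : {X : Set} → (X → Set) → ℕ → Set
HasSize P n = ∃[ xs ] Unique xs × (∀ x → x ∈ xs ⇔ P x) × length xs ≡ n

Palindrome : {A : Set} → List A → Set
Palindrome w = w ≡ reverse w

module _ {A : Set} (u : ℕ → A) where

  EveryLetterOccurs : Set
  EveryLetterOccurs = ∀ a → ∃[ i ] u i ≡ a

  factorAt : ℕ → ℕ → List A
  factorAt i n = applyUpTo (λ j → u (i + j)) n

  𝓛 : List A → Set
  𝓛 w = ∃[ i ] factorAt i (length w) ≡ w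

  ClosedUnderReversal : Set
  ClosedUnderReversal = ∀ w → 𝓛 w → 𝓛 (reverse w)

  -- Complexity n c says 𝓒(n) = c.
  Complexity : ℕ → ℕ → Set
  Complexity n c = HasSize (λ w → length w ≡ n × 𝓛 w) c

  Lext : List A → A → Set
  Lext w a = 𝓛 (a ∷ w)

  Rext : List A → A → Set
  Rext w a = 𝓛 (w ∷ʳ a)

  Bext : List A → List A → Set
  Bext w v = 𝓛 v × (∃[ a ] ∃[ b ] v ≡ a ∷ (w ∷ʳ b))

  PalindromicExtension : List A → List A → Set
  PalindromicExtension w v = 𝓛 v × (∃[ a ] v ≡ a ∷ (w ∷ʳ a))

  UniquePalindromicExtensions : Set
  UniquePalindromicExtensions =
    ∀ w → 𝓛 w → Palindrome w → ∃! _≡_ (PalindromicExtension w)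

  Bispecial : List A → Set
  Bispecial w =
    𝓛 w × (∃[ l ] HasSize (Lext w) l × 2 ≤ l) × (∃[ r ] HasSize (Rext w) r × 2 ≤ r)

  -- BilateralOrder w z says b(w) = z.
  BilateralOrder : List A → ℤ → Set
  BilateralOrder w z =
    ∃[ b ] ∃[ r ] ∃[ l ]
      HasSize (Bext w) b × HasSize (Rext w) r × HasSize (Lext w) l ×
      z ≡ + b ℤ.- + r ℤ.- + l ℤ.+ 1ℤ

  Ordinary : List A → Set
  Ordinary w = Bispecial w × BilateralOrder w 0ℤ

  AllBispecialOrdinary : Set
  AllBispecialOrdinary = ∀ w → Bispecial w → Ordinary w

{-# OPTIONS --safe #-}

-- Identify each factor with its reversal and drop the palindromic edges, which become loops, from
-- the Rauzy graph of order n.  The walk traced by u shows that what remains is connected, so it has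
-- at least as many edges as vertices minus one; counting the orbits of reversal, this says
-- P(n) + P(n+1) ≤ C(n+1) − C(n) + 2, where P counts palindromes.  If every palindrome extends to a
-- palindrome, then P(n) ≤ P(n+2), and as P(0) + P(1) = k + 1 all these bounds are equalities:
-- palindromic extensions are unique and every quotient graph is a tree.
--
-- If all bispecial factors are ordinary, a bispecial palindrome w has a palindromic extension because
-- # Bext(w) = 2 # Lext(w) − 1 is odd, whereas reversal pairs off the other extensions.
--
-- Conversely, if palindromic extensions are unique, the extensions awb of w are edges of a forest on
-- the vertices aw and wb of the quotient tree of order |w| + 1, which gives b(w) ≤ 0.  The sum of
-- b(w) over the words w of length n is C(n+2) − 2 C(n+1) + C(n) = 0, so every b(w) is 0.
module Submission where

open import Defs
open import Data.Bool.Base using (Bool; true; false)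
open import Data.Fin.Base using (Fin)
import Data.Fin.Properties as Fin
open import Data.Integer.Base as ℤ using (0ℤ; 1ℤ) renaming (+_ to pos)
import Data.Integer.Properties as ℤ
import Data.Integer.Tactic.RingSolver as ℤSolver
open import Data.List.Base hiding (sum; find)
open import Data.List.Membership.Propositional using (_∈_; find; lose)
open import Data.List.Membership.Propositional.Properties
open import Data.List.Properties
open import Data.List.Relation.Binary.Permutation.Propositional
  using (_↭_; swap; ↭-sym; ↭-trans; ↭-refl; ↭-reflexive)
open import Data.List.Relation.Binary.Permutation.Propositional.Properties
  using (drop-∷; ↭-reverse; ∷↭∷ʳ; ↭-singleton-inv)
open import Data.List.Relation.Unary.All as All using ([]; _∷_)
open import Data.List.Relation.Unary.All.Properties using (¬Any⇒All¬; ¬All⇒Any¬; all-filter)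
open import Data.List.Relation.Unary.AllPairs as AllPairs using (AllPairs; []; _∷_)
import Data.List.Relation.Unary.AllPairs.Properties as AllPairs
open import Data.List.Relation.Unary.Any as Any using (Any; here; there)
import Data.List.Relation.Unary.Any.Properties as Any
open import Data.List.Relation.Unary.Unique.Propositional using (Unique)
import Data.List.Relation.Unary.Unique.Propositional.Properties as Unique
open import Data.Nat.Base
open import Data.Nat.ListAction using (sum)
open import Data.Nat.Properties hiding (_≟_)
open import Data.Nat.Tactic.RingSolver using (solve-∀)
open import Data.Product using (∃-syntax; ∃₂; _×_; _,_; proj₁; proj₂; map₂)
open import Data.Sum.Base as Sum using (_⊎_; inj₁; inj₂)
open import Function.Base using (_∘_)
open import Function.Bundles using (_⇔_; mk⇔; _↔_; module Equivalence; module Inverse)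
open import Function.Properties.Inverse using (↔⇒↣)
open import Relation.Binary.Definitions using (DecidableEquality) renaming (Decidable to Decidable₂)
open import Relation.Binary.PropositionalEquality hiding ([_])
open import Relation.Nullary using (¬_; yes; no; contradiction)
open import Relation.Nullary.Decidable using (_⊎-dec_; ¬?; map′; decidable-stable; via-injection)
open import Relation.Unary using (Decidable)

open Equivalence using (to; from)

private variable
  X Y : Set
  xs ys : List X

-- Counting with duplicate-free lists.

length-⊆ : Unique xs → (∀ {x} → x ∈ xs → x ∈ ys) → length xs ≤ length ys
length-⊆ [] _ = z≤n
length-⊆ {xs = x ∷ xs} (x∉xs ∷ xs!) xs⊆ys with ∈-∃++ (xs⊆ys (here refl))
-- The occurrence of `x` in `ys` is cut out; as `x` does not recur in `xs`, the other elements are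
-- still found in what remains.
... | us , vs , refl = begin
  suc (length xs)            ≤⟨ s≤s (length-⊆ xs! xs⊆us++vs) ⟩
  suc (length (us ++ vs))    ≡⟨ cong suc (length-++ us) ⟩
  suc (length us + length vs) ≡⟨ +-suc (length us) (length vs) ⟨
  length us + suc (length vs) ≡⟨ length-++ us ⟨
  length (us ++ x ∷ vs)      ∎
  where
  open ≤-Reasoning
  xs⊆us++vs : ∀ {y} → y ∈ xs → y ∈ us ++ vs
  xs⊆us++vs y∈xs with ∈-++⁻ us (xs⊆ys (there y∈xs))
  ... | inj₁ y∈us         = ∈-++⁺ˡ y∈us
  ... | inj₂ (here refl)  = contradiction refl (All.lookup x∉xs y∈xs)
  ... | inj₂ (there y∈vs) = ∈-++⁺ʳ us y∈vs

HasSize-unique : ∀ {P : X → Set} {m n} → HasSize P m → HasSize P n → m ≡ n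
HasSize-unique (xs , xs! , xs⇔ , refl) (ys , ys! , ys⇔ , refl) = ≤-antisym
  (length-⊆ xs! (from (ys⇔ _) ∘ to (xs⇔ _)))
  (length-⊆ ys! (from (xs⇔ _) ∘ to (ys⇔ _)))

length≤1⇒≡ : ∀ {x y} → x ∈ xs → y ∈ xs → length xs ≤ 1 → x ≡ y
length≤1⇒≡ (here refl) (here refl) _ = refl
length≤1⇒≡ {xs = _ ∷ []} (here _) (there ()) _
length≤1⇒≡ {xs = _ ∷ []} (there ()) _ _
length≤1⇒≡ {xs = _ ∷ _ ∷ _} _ _ (s≤s ())

Unique⇒AllPairs : ∀ {R : X → X → Set} → Unique xs →
  (∀ {x y} → x ∈ xs → y ∈ xs → x ≢ y → R x y) → AllPairs R xs
Unique⇒AllPairs [] _ = []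
Unique⇒AllPairs (x∉xs ∷ xs!) r =
  All.tabulate (λ y∈xs → r (here refl) (there y∈xs) (All.lookup x∉xs y∈xs)) ∷
  Unique⇒AllPairs xs! (λ x∈ y∈ → r (there x∈) (there y∈))

Unique-concatMap : (f : X → List Y) → Unique xs → (∀ x → Unique (f x)) →
  (∀ {x x′ y} → y ∈ f x → y ∈ f x′ → x ≡ x′) → Unique (concatMap f xs)
Unique-concatMap f xs! f! f-disjoint = Unique.concat⁺
  (All.tabulate λ ys∈ → let _ , _ , eq = ∈-map⁻ f ys∈ in subst Unique (sym eq) (f! _))
  (AllPairs.map⁺ (AllPairs.map (λ x≢x′ {_} (p , q) → x≢x′ (f-disjoint p q)) xs!))

length-concatMap : (f : X → List Y) (xs : List X) →
  length (concatMap f xs) ≡ sum (map (length ∘ f) xs)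
length-concatMap f []       = refl
length-concatMap f (x ∷ xs) =
  trans (length-++ (f x)) (cong (length (f x) +_) (length-concatMap f xs))

sum-map-+ : (f g : X → ℕ) (xs : List X) →
  sum (map (λ x → f x + g x) xs) ≡ sum (map f xs) + sum (map g xs)
sum-map-+ f g []       = refl
sum-map-+ f g (x ∷ xs) = trans (cong (f x + g x +_) (sum-map-+ f g xs))
  (interchange (f x) (g x) _ _)
  where
  interchange : ∀ a b c d → a + b + (c + d) ≡ a + c + (b + d)
  interchange = solve-∀

sum-map-1 : (xs : List X) → sum (map (λ _ → 1) xs) ≡ length xs
sum-map-1 []       = refl
sum-map-1 (_ ∷ xs) = cong suc (sum-map-1 xs)

sum-map-≤ : (f g : X → ℕ) (xs : List X) → (∀ {x} → x ∈ xs → f x ≤ g x) →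
  sum (map f xs) ≤ sum (map g xs)
sum-map-≤ f g []       _   = z≤n
sum-map-≤ f g (x ∷ xs) f≤g = +-mono-≤ (f≤g (here refl)) (sum-map-≤ f g xs (f≤g ∘ there))

-- A strict inequality at one term could not be made up by the others.
sum-map-squeeze : (f g : X → ℕ) (xs : List X) → (∀ {x} → x ∈ xs → f x ≤ g x) →
  sum (map g xs) ≤ sum (map f xs) → ∀ {x} → x ∈ xs → f x ≡ g x
sum-map-squeeze f g (x ∷ xs) f≤g Σg≤Σf (here refl) = ≤-antisym (f≤g (here refl))
  (+-cancelʳ-≤ (sum (map f xs)) _ _
    (≤-trans (+-monoʳ-≤ (g x) (sum-map-≤ f g xs (f≤g ∘ there))) Σg≤Σf))
sum-map-squeeze f g (x ∷ xs) f≤g Σg≤Σf (there y∈xs) =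
  sum-map-squeeze f g xs (f≤g ∘ there)
    (+-cancelˡ-≤ (f x) _ _ (≤-trans (+-monoˡ-≤ _ (f≤g (here refl))) Σg≤Σf)) y∈xs

AllPairs-deduplicate : ∀ {R : X → X → Set} (R? : Decidable₂ R) (xs : List X) →
  AllPairs (λ x y → ¬ R x y) (deduplicate R? xs)
AllPairs-deduplicate R? []       = []
AllPairs-deduplicate R? (x ∷ xs) =
  all-filter (¬? ∘ R? x) (deduplicate R? xs) ∷
  AllPairs.filter⁺ (¬? ∘ R? x) (AllPairs-deduplicate R? xs)

first-exit : ∀ {P : ℕ → Set} → Decidable P → P 0 → ∀ n → ¬ P n → ∃[ m ] P m × ¬ P (suc m)
first-exit P? p0 zero    ¬pn = contradiction p0 ¬pn
first-exit P? p0 (suc n) ¬pn with P? n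
... | yes pn = n , pn , ¬pn
... | no ¬pn = first-exit P? p0 n ¬pn

-- Starting from 0 avoids comparing `i` with `j`: if `P 0` holds then `P` is lost before `j`, and
-- otherwise it is gained before `i`. Hence the two directions of change.
change : ∀ {P : ℕ → Set} → Decidable P → ∀ i j → P i → ¬ P j →
  ∃[ m ] ((P m × ¬ P (suc m)) ⊎ (¬ P m × P (suc m)))
change P? i j pi ¬pj with P? 0
... | yes p0 = map₂ inj₁ (first-exit P? p0 j ¬pj)
... | no ¬p0 = map₂ (λ (¬pm , ¬¬psm) → inj₂ (¬pm , decidable-stable (P? _) ¬¬psm))
  (first-exit (¬? ∘ P?) ¬p0 i (λ ¬pi → ¬pi pi))

-- Reversal and the two ends of a word.

reverse-∷ʳ : (xs : List X) (x : X) → reverse (xs ∷ʳ x) ≡ x ∷ reverse xs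
reverse-∷ʳ xs x = reverse-++ xs [ x ]

reverse-∷-∷ʳ : (x : X) (xs : List X) (y : X) →
  reverse (x ∷ (xs ∷ʳ y)) ≡ y ∷ (reverse xs ∷ʳ x)
reverse-∷-∷ʳ x xs y =
  trans (unfold-reverse x (xs ∷ʳ y)) (cong (_∷ʳ x) (reverse-∷ʳ xs y))

∷-∷ʳ-injective : ∀ {a b c d : X} xs ys →
  a ∷ (xs ∷ʳ b) ≡ c ∷ (ys ∷ʳ d) → a ≡ c × xs ≡ ys × b ≡ d
∷-∷ʳ-injective xs ys eq =
  ∷-injectiveˡ eq , ∷ʳ-injective xs ys (∷-injectiveʳ eq)

length-∷ʳ : (xs : List X) (x : X) → length (xs ∷ʳ x) ≡ suc (length xs)
length-∷ʳ xs x = trans (length-++ xs) (+-comm (length xs) 1)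

-- A total function undoing every extension `a ∷ (w ∷ʳ b)`, so that the extensions of `w` can be
-- found by filtering.
inner : List X → List X
inner w = reverse (drop 1 (reverse (drop 1 w)))

inner-∷-∷ʳ : (x : X) (xs : List X) (y : X) → inner (x ∷ (xs ∷ʳ y)) ≡ xs
inner-∷-∷ʳ x xs y =
  trans (cong (reverse ∘ drop 1) (reverse-∷ʳ xs y)) (reverse-involutive xs)

length-2+⇒∷-∷ʳ : ∀ {n} (v : List X) → length v ≡ 2 + n →
  ∃[ a ] ∃[ w ] ∃[ b ] v ≡ a ∷ (w ∷ʳ b) × length w ≡ n
length-2+⇒∷-∷ʳ (a ∷ v) |v| with initLast v
... | w ∷ʳ′ b = a , w , b , refl , suc-injective (trans (sym (length-∷ʳ w b)) (suc-injective |v|))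

-- Common letters cancel one at a time. An added letter is thus determined by the multiset of
-- letters, which reversal does not change.
∷-↭-injective : ∀ {a b : X} (xs : List X) → a ∷ xs ↭ b ∷ xs → a ≡ b
∷-↭-injective []       p = ∷-injectiveˡ (↭-singleton-inv p)
∷-↭-injective (x ∷ xs) p =
  ∷-↭-injective xs (drop-∷ (↭-trans (swap x _ ↭-refl) (↭-trans p (swap _ x ↭-refl))))

-- The equation passes to the tail of `w`, which is a palindrome by induction; comparing multisets
-- identifies `b` with the first letter of `w`.
∷≡∷ʳ⇒palindrome : ∀ {a b : X} (w : List X) → a ∷ w ≡ w ∷ʳ b → Palindrome w
∷≡∷ʳ⇒palindrome []      _  = refl
∷≡∷ʳ⇒palindrome {a = a} {b} (x ∷ w) eq =
  trans (∷-injectiveʳ eq) (trans (cong₂ _∷ʳ_ w-pal b≡x) (sym (unfold-reverse x w)))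
  where
  w-pal : Palindrome w
  w-pal = ∷≡∷ʳ⇒palindrome w (∷-injectiveʳ eq)
  b≡x : b ≡ x
  b≡x = sym (∷-↭-injective w (↭-trans (↭-reflexive (∷-injectiveʳ eq)) (↭-sym (∷↭∷ʳ b w))))

-- Words up to reversal and the counting of their classes.

infix 4 _≃_

_≃_ : List X → List X → Set
x ≃ y = x ≡ y ⊎ x ≡ reverse y

≃-refl : ∀ {x : List X} → x ≃ x
≃-refl = inj₁ refl

≃-reverse : (x : List X) → reverse x ≃ x
≃-reverse x = inj₂ refl

≃-sym : ∀ {x y : List X} → x ≃ y → y ≃ x
≃-sym (inj₁ refl) = ≃-refl
≃-sym {y = y} (inj₂ refl) = inj₂ (sym (reverse-involutive y))

≃-trans : ∀ {x y z : List X} → x ≃ y → y ≃ z → x ≃ z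
≃-trans (inj₁ refl) q = q
≃-trans (inj₂ refl) (inj₁ refl) = inj₂ refl
≃-trans {z = z} (inj₂ refl) (inj₂ refl) = inj₁ (reverse-involutive z)

≃⇒↭ : ∀ {x y : List X} → x ≃ y → x ↭ y
≃⇒↭ (inj₁ refl) = ↭-refl
≃⇒↭ {y = y} (inj₂ refl) = ↭-reverse y

≃-palindrome : ∀ {x y : List X} → Palindrome x → x ≃ y → x ≡ y
≃-palindrome x-pal (inj₁ x≡y) = x≡y
≃-palindrome {y = y} x-pal (inj₂ x≡ȳ) = trans x-pal (trans (cong reverse x≡ȳ) (reverse-involutive y))

_≄_ : List X → List X → Set
x ≄ y = ¬ x ≃ y

module Reversal {A : Set} (_≟_ : DecidableEquality A) where

  infix 4 _≟ʷ_ _≃?_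

  _≟ʷ_ : DecidableEquality (List A)
  _≟ʷ_ = ≡-dec _≟_

  palindrome? : Decidable (Palindrome {A})
  palindrome? w = w ≟ʷ reverse w

  _≃?_ : Decidable₂ (_≃_ {A})
  x ≃? y = (x ≟ʷ y) ⊎-dec (x ≟ʷ reverse y)

  representatives : List (List A) → List (List A)
  representatives = deduplicate _≃?_

  ∈-representatives : ∀ {w ws} → w ∈ ws → Any (w ≃_) (representatives ws)
  ∈-representatives w∈ws = Any.deduplicate⁺ _≃?_
    (λ y≃x w≃x → ≃-trans w≃x (≃-sym y≃x))
    (Any.map inj₁ w∈ws)

  -- A class {w , reverse w} contributes 2 to the left-hand side whether it has one or two elements.
  covering-bound : ∀ {ws reps} → Unique ws → (∀ {w} → w ∈ ws → Any (w ≃_) reps) →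
    length ws + length (filter palindrome? ws) ≤ 2 * length reps
  covering-bound {ws} {reps} ws! cover = begin
    length ws + length pals                            ≡⟨ cong₂ _+_ (length-map _ ws) (length-map _ pals) ⟨
    length (map (tag true) ws) + length (map (tag false) pals) ≡⟨ length-++ (map (tag true) ws) ⟨
    length (map (tag true) ws ++ map (tag false) pals)   ≤⟨ length-⊆ tagged! tagged⊆ ⟩
    length (map (tag true) reps ++ map second reps)     ≡⟨ length-++ (map (tag true) reps) ⟩
    length (map (tag true) reps) + length (map second reps) ≡⟨ cong₂ _+_ (length-map _ reps) (length-map second reps) ⟩
    length reps + length reps                          ≡⟨ cong (length reps +_) (+-identityʳ _) ⟨
    2 * length reps                                    ∎
    where
    open ≤-Reasoning
    pals : List (List A)
    pals = filter palindrome? ws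
    -- The tags separate the two copies of a palindrome, one from `ws` and one from `pals`.
    tag : Bool → List A → Bool × List A
    tag = _,_
    -- Each representative supplies two tagged words: itself under `true`, and here its second copy
    -- if it is a palindrome or its reversal if it is not.
    second : List A → Bool × List A
    second r with palindrome? r
    ... | yes _ = false , r
    ... | no  _ = true , reverse r
    second-pal : ∀ {r} → Palindrome r → second r ≡ (false , r)
    second-pal {r} p with palindrome? r
    ... | yes _ = refl
    ... | no ¬p = contradiction p ¬p
    second-nonpal : ∀ {r} → ¬ Palindrome r → second r ≡ (true , reverse r)
    second-nonpal {r} ¬p with palindrome? r
    ... | yes p = contradiction p ¬p
    ... | no _  = refl
    tagged! : Unique (map (tag true) ws ++ map (tag false) pals)
    tagged! = Unique.++⁺ (Unique.map⁺ (cong proj₂) ws!)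
      (Unique.map⁺ (cong proj₂) (Unique.filter⁺ palindrome? ws!))
      tags-disjoint
      where
      tags-disjoint : ∀ {v} → ¬ (v ∈ map (tag true) ws × v ∈ map (tag false) pals)
      tags-disjoint (p , q) with ∈-map⁻ (tag true) p | ∈-map⁻ (tag false) q
      ... | _ , _ , refl | _ , _ , ()
    tagged⊆ : ∀ {v} → v ∈ map (tag true) ws ++ map (tag false) pals →
      v ∈ map (tag true) reps ++ map second reps
    tagged⊆ v∈ with ∈-++⁻ (map (tag true) ws) v∈
    ... | inj₁ p with ∈-map⁻ _ p
    ...   | w , w∈ws , refl with find (cover w∈ws)
    ...     | r , r∈ , inj₁ refl = ∈-++⁺ˡ (∈-map⁺ _ r∈)
    ...     | r , r∈ , inj₂ refl with palindrome? r
    ...       | yes r-pal = ∈-++⁺ˡ (subst (λ x → (true , x) ∈ map (tag true) reps) r-pal (∈-map⁺ _ r∈))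
    ...       | no ¬r-pal = ∈-++⁺ʳ _ (subst (_∈ map second reps) (second-nonpal ¬r-pal) (∈-map⁺ second r∈))
    tagged⊆ v∈ | inj₂ p with ∈-map⁻ _ p
    ...   | w , w∈pals , refl with ∈-filter⁻ palindrome? {xs = ws} w∈pals
    ...     | w∈ws , w-pal with find (cover w∈ws)
    ...       | r , r∈ , w≃r with ≃-palindrome w-pal w≃r
    ...         | refl = ∈-++⁺ʳ _ (subst (_∈ map second reps) (second-pal w-pal) (∈-map⁺ second r∈))

  -- The representatives, their reversals and the palindromes of `ws` are three disjoint families
  -- inside `ws`.
  packing-bound : ∀ {ws reps} → AllPairs _≄_ reps → (∀ {w} → w ∈ reps → w ∈ ws) →
    (∀ {w} → w ∈ reps → ¬ Palindrome w) → (∀ {w} → w ∈ ws → reverse w ∈ ws) → Unique ws →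
    2 * length reps + length (filter palindrome? ws) ≤ length ws
  packing-bound {ws} {reps} reps≄ reps⊆ws reps-nonpal ws-closed ws! = begin
    2 * length reps + length pals                      ≡⟨ cong (λ n → length reps + n + length pals) (+-identityʳ _) ⟩
    length reps + length reps + length pals            ≡⟨ cong (λ n → length reps + n + length pals) (length-map reverse reps) ⟨
    length reps + length (map reverse reps) + length pals ≡⟨ cong (_+ length pals) (length-++ reps) ⟨
    length (reps ++ map reverse reps) + length pals    ≡⟨ length-++ (reps ++ map reverse reps) ⟨
    length ((reps ++ map reverse reps) ++ pals)        ≤⟨ length-⊆ all! all⊆ ⟩
    length ws                                          ∎
    where
    open ≤-Reasoning
    pals : List (List A)
    pals = filter palindrome? ws
    reps! : Unique reps
    reps! = AllPairs.map (λ x≄y x≡y → x≄y (inj₁ x≡y)) reps≄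
    reps≃⇒≡ : ∀ {x y} {rs : List (List A)} → AllPairs _≄_ rs → x ∈ rs → y ∈ rs → x ≃ y → x ≡ y
    reps≃⇒≡ (_ ∷ _)  (here refl) (here refl) _   = refl
    reps≃⇒≡ (p ∷ _)  (here refl) (there y∈)  x≃y = contradiction x≃y (All.lookup p y∈)
    reps≃⇒≡ (p ∷ _)  (there x∈)  (here refl) x≃y = contradiction (≃-sym x≃y) (All.lookup p x∈)
    reps≃⇒≡ (_ ∷ ps) (there x∈)  (there y∈)  x≃y = reps≃⇒≡ ps x∈ y∈ x≃y
    reps-disjoint : ∀ {x} → ¬ (x ∈ reps × x ∈ map reverse reps)
    reps-disjoint (p , q) with ∈-map⁻ reverse q
    ... | r , r∈ , refl = reps-nonpal r∈ (sym (reps≃⇒≡ reps≄ p r∈ (inj₂ refl)))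
    nonpal : ∀ {x} → x ∈ reps ++ map reverse reps → ¬ Palindrome x
    nonpal x∈ with ∈-++⁻ reps x∈
    ... | inj₁ p = reps-nonpal p
    ... | inj₂ q with ∈-map⁻ reverse q
    ...   | r , r∈ , refl = λ r̄-pal → reps-nonpal r∈ (sym (trans r̄-pal (reverse-involutive r)))
    all! : Unique ((reps ++ map reverse reps) ++ pals)
    all! = Unique.++⁺ (Unique.++⁺ reps! (Unique.map⁺ reverse-injective reps!) reps-disjoint)
      (Unique.filter⁺ palindrome? ws!)
      (λ (p , q) → nonpal p (proj₂ (∈-filter⁻ palindrome? {xs = ws} q)))
    all⊆ : ∀ {x} → x ∈ (reps ++ map reverse reps) ++ pals → x ∈ ws
    all⊆ x∈ with ∈-++⁻ (reps ++ map reverse reps) x∈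
    ... | inj₂ q = proj₁ (∈-filter⁻ palindrome? q)
    ... | inj₁ p with ∈-++⁻ reps p
    ...   | inj₁ x∈reps = reps⊆ws x∈reps
    ...   | inj₂ q with ∈-map⁻ reverse q
    ...     | r , r∈ , refl = ws-closed (reps⊆ws r∈)

-- Factors and palindromes of the infinite word.

module Language {A : Set} (_≟_ : DecidableEquality A) (u : ℕ → A)
  (reversal : ClosedUnderReversal u)
  (𝓒 : ℕ → ℕ) (complexity : ∀ n → Complexity u n (𝓒 n))
  where

  open Reversal _≟_

  factorAt-∷ : ∀ i n → factorAt u i (suc n) ≡ u i ∷ factorAt u (suc i) n
  factorAt-∷ i n = cong₂ _∷_ (cong u (+-identityʳ i)) (applyUpTo-cong n λ j → cong u (+-suc i j))
    where
    applyUpTo-cong : ∀ {f g : ℕ → A} n → (∀ j → f j ≡ g j) → applyUpTo f n ≡ applyUpTo g n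
    applyUpTo-cong zero    f≗g = refl
    applyUpTo-cong (suc n) f≗g = cong₂ _∷_ (f≗g 0) (applyUpTo-cong n (f≗g ∘ suc))

  factorAt-∷ʳ : ∀ i n → factorAt u i (suc n) ≡ factorAt u i n ∷ʳ u (i + n)
  factorAt-∷ʳ i n = sym (applyUpTo-∷ʳ _ n)

  length-factorAt : ∀ i n → length (factorAt u i n) ≡ n
  length-factorAt i n = length-applyUpTo _ n

  𝓛-factorAt : ∀ i n → 𝓛 u (factorAt u i n)
  𝓛-factorAt i n = i , cong (factorAt u i) (length-factorAt i n)

  𝓛-∷⁻ : ∀ {a w} → 𝓛 u (a ∷ w) → 𝓛 u w
  𝓛-∷⁻ {w = w} (i , eq) = suc i , ∷-injectiveʳ (trans (sym (factorAt-∷ i (length w))) eq)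

  𝓛-reverse⁻ : ∀ {w} → 𝓛 u (reverse w) → 𝓛 u w
  𝓛-reverse⁻ {w} = subst (𝓛 u) (reverse-involutive w) ∘ reversal (reverse w)

  𝓛-∷ʳ⁻ : ∀ {w a} → 𝓛 u (w ∷ʳ a) → 𝓛 u w
  𝓛-∷ʳ⁻ {w} {a} wa∈𝓛 =
    𝓛-reverse⁻ (𝓛-∷⁻ (subst (𝓛 u) (reverse-∷ʳ w a) (reversal (w ∷ʳ a) wa∈𝓛)))

  right-extendable : ∀ {w} → 𝓛 u w → ∃[ a ] 𝓛 u (w ∷ʳ a)
  right-extendable {w} (i , eq) = u (i + length w) ,
    subst (𝓛 u) (trans (factorAt-∷ʳ i (length w)) (cong (_∷ʳ u (i + length w)) eq))
      (𝓛-factorAt i (suc (length w)))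

  -- A one-sided word continues to the right only; closure under reversal carries this over to the
  -- left.
  left-extendable : ∀ {w} → 𝓛 u w → ∃[ a ] 𝓛 u (a ∷ w)
  left-extendable {w} w∈𝓛 with right-extendable (reversal w w∈𝓛)
  ... | a , w̄a∈𝓛 = a , 𝓛-reverse⁻ (subst (𝓛 u) (sym (unfold-reverse a w)) w̄a∈𝓛)

  factors : ℕ → List (List A)
  factors n = proj₁ (complexity n)

  factors! : ∀ n → Unique (factors n)
  factors! n = proj₁ (proj₂ (complexity n))

  length-factors : ∀ n → length (factors n) ≡ 𝓒 n
  length-factors n = proj₂ (proj₂ (proj₂ (complexity n)))

  ∈-factors⁺ : ∀ {n w} → length w ≡ n → 𝓛 u w → w ∈ factors n
  ∈-factors⁺ {n} |w| w∈𝓛 = from (proj₁ (proj₂ (proj₂ (complexity n))) _) (|w| , w∈𝓛)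

  ∈-factors⁻ : ∀ {n w} → w ∈ factors n → length w ≡ n × 𝓛 u w
  ∈-factors⁻ {n} = to (proj₁ (proj₂ (proj₂ (complexity n))) _)

  factorAt-∈-factors : ∀ i n → factorAt u i n ∈ factors n
  factorAt-∈-factors i n = ∈-factors⁺ (length-factorAt i n) (𝓛-factorAt i n)

  ∈-factors⇒factorAt : ∀ {n w} → w ∈ factors n → ∃[ i ] factorAt u i n ≡ w
  ∈-factors⇒factorAt w∈ with ∈-factors⁻ w∈
  ... | refl , i , eq = i , eq

  factors-reverse : ∀ {n w} → w ∈ factors n → reverse w ∈ factors n
  factors-reverse {w = w} w∈ with ∈-factors⁻ w∈
  ... | |w| , w∈𝓛 = ∈-factors⁺ (trans (length-reverse w) |w|) (reversal w w∈𝓛)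

  -- The complexity hypothesis supplies a finite list of all factors of each length, in which `w`
  -- can be searched for.
  𝓛? : Decidable (𝓛 u)
  𝓛? w = map′ (proj₂ ∘ ∈-factors⁻) (∈-factors⁺ refl) (Any.any? (w ≟ʷ_) (factors (length w)))

  palindromes : ℕ → List (List A)
  palindromes n = filter palindrome? (factors n)

  𝓟 : ℕ → ℕ
  𝓟 n = length (palindromes n)

  ∈-palindromes⁺ : ∀ {n w} → length w ≡ n → 𝓛 u w → Palindrome w → w ∈ palindromes n
  ∈-palindromes⁺ |w| w∈𝓛 w-pal = ∈-filter⁺ palindrome? (∈-factors⁺ |w| w∈𝓛) w-pal

  ∈-palindromes⁻ : ∀ {n w} → w ∈ palindromes n → length w ≡ n × 𝓛 u w × Palindrome w
  ∈-palindromes⁻ {n} w∈ with ∈-filter⁻ palindrome? {xs = factors n} w∈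
  ... | w∈factors , w-pal with ∈-factors⁻ w∈factors
  ... | |w| , w∈𝓛 = |w| , w∈𝓛 , w-pal

  -- The Rauzy graph modulo reversal.

  -- The Rauzy graph has the factors of length n as vertices and those of length n + 1 as edges,
  -- an edge leading from its prefix to its suffix.
  record Inside (X : List (List A)) (e : List A) : Set where
    field
      suffix : ∀ {a p} → e ≡ a ∷ p → Any (p ≃_) X
      prefix : ∀ {q b} → e ≡ q ∷ʳ b → Any (q ≃_) X

  open Inside

  Any-≃ : ∀ {v w : List A} {X} → v ≃ w → Any (w ≃_) X → Any (v ≃_) X
  Any-≃ v≃w = Any.map (≃-trans v≃w)

  -- Reversal exchanges the two ends of an edge, up to reversing them, and ends are matched with `X`
  -- only up to reversal.
  Inside-reverse : ∀ {X e} → Inside X e → Inside X (reverse e)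
  Inside-reverse {e = e} e-in .suffix {a} {p} ē≡ap = Any-≃ (≃-sym (≃-reverse p))
    (e-in .prefix (trans (sym (reverse-involutive e)) (trans (cong reverse ē≡ap) (unfold-reverse a p))))
  Inside-reverse {e = e} e-in .prefix {q} {b} ē≡qb = Any-≃ (≃-sym (≃-reverse q))
    (e-in .suffix (trans (sym (reverse-involutive e)) (trans (cong reverse ē≡qb) (reverse-∷ʳ q b))))

  Inside-≃ : ∀ {X e f} → e ≃ f → Inside X f → Inside X e
  Inside-≃ (inj₁ refl) f-in = f-in
  Inside-≃ (inj₂ refl) f-in = Inside-reverse f-in

  Inside-∷ : ∀ {X x e} → Inside X e → Inside (x ∷ X) e
  Inside-∷ e-in .suffix eq = there (e-in .suffix eq)
  Inside-∷ e-in .prefix eq = there (e-in .prefix eq)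

  Inside-edge : ∀ {X a p q b} → a ∷ p ≡ q ∷ʳ b → Any (p ≃_) X → Any (q ≃_) X → Inside X (a ∷ p)
  Inside-edge ap≡qb p∈X q∈X .suffix eq with refl ← ∷-injectiveʳ eq = p∈X
  Inside-edge {q = q} ap≡qb p∈X q∈X .prefix {q′} eq
    with refl ← ∷ʳ-injectiveˡ q q′ (trans (sym ap≡qb) eq) = q∈X

  -- Part of the quotient of the Rauzy graph by reversal: X lists representatives of vertices and
  -- F representatives of edges between them; palindromic edges become loops, and are left out.
  record Subgraph (n : ℕ) (X F : List (List A)) : Set where
    field
      X⊆factors : ∀ {x} → x ∈ X → x ∈ factors n
      X≄        : AllPairs _≄_ X
      F⊆factors : ∀ {e} → e ∈ F → e ∈ factors (suc n)
      F≄        : AllPairs _≄_ F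
      F-nonpal  : ∀ {e} → e ∈ F → ¬ Palindrome e
      F-inside  : ∀ {e} → e ∈ F → Inside X e

  open Subgraph

  -- An edge of the quotient between a vertex of `X` and a new vertex: what one step of growth adds.
  record Boundary (n : ℕ) (X : List (List A)) : Set where
    field
      {vertex edge} : List A
      vertex∈  : vertex ∈ factors n
      vertex∉X : ¬ Any (vertex ≃_) X
      edge∈    : edge ∈ factors (suc n)
      nonpal   : ¬ Palindrome edge
      outside  : ¬ Inside X edge
      inside   : Inside (vertex ∷ X) edge

  -- The word u itself walks between a vertex in X and one outside X.
  boundary : ∀ {n X x v} → x ∈ X → x ∈ factors n → v ∈ factors n → ¬ Any (v ≃_) X → Boundary n X
  boundary {n} {X} x∈X x∈ v∈ v∉X
    with i , refl ← ∈-factors⇒factorAt x∈ | j , refl ← ∈-factors⇒factorAt v∈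
    with change (λ m → Any.any? (factorAt u m n ≃?_) X) i j (lose x∈X ≃-refl) v∉X
  ... | m , crossing = exit crossing
    where
    p q : List A
    p = factorAt u (suc m) n
    q = factorAt u m n

    ap≡qb : u m ∷ p ≡ q ∷ʳ u (m + n)
    ap≡qb = trans (sym (factorAt-∷ m n)) (factorAt-∷ʳ m n)

    -- The ends of a palindromic edge are reversals of each other, so the edge where the walk
    -- crosses the border of `X` is not a palindrome.
    palindrome⇒p≃q : Palindrome (u m ∷ p) → p ≃ q
    palindrome⇒p≃q e-pal = inj₂ (∷-injectiveʳ
      (trans e-pal (trans (cong reverse ap≡qb) (reverse-∷ʳ q _))))

    e∈ : u m ∷ p ∈ factors (suc n)
    e∈ = subst (_∈ factors (suc n)) (factorAt-∷ m n) (factorAt-∈-factors m (suc n))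

    exit : (Any (q ≃_) X × ¬ Any (p ≃_) X) ⊎ (¬ Any (q ≃_) X × Any (p ≃_) X) → Boundary n X
    exit (inj₁ (q∈X , p∉X)) = record
      { vertex∈  = factorAt-∈-factors (suc m) n
      ; vertex∉X = p∉X
      ; edge∈    = e∈
      ; nonpal   = λ e-pal → p∉X (Any-≃ (palindrome⇒p≃q e-pal) q∈X)
      ; outside  = λ e-in → p∉X (e-in .suffix refl)
      ; inside   = Inside-edge ap≡qb (here ≃-refl) (there q∈X)
      }
    exit (inj₂ (q∉X , p∈X)) = record
      { vertex∈  = factorAt-∈-factors m n
      ; vertex∉X = q∉X
      ; edge∈    = e∈
      ; nonpal   = λ e-pal → q∉X (Any-≃ (≃-sym (palindrome⇒p≃q e-pal)) p∈X)
      ; outside  = λ e-in → q∉X (e-in .prefix ap≡qb)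
      ; inside   = Inside-edge ap≡qb (there p∈X) (here ≃-refl)
      }

  extend : ∀ {n X F} → Subgraph n X F → (b : Boundary n X) →
    Subgraph n (Boundary.vertex b ∷ X) (Boundary.edge b ∷ F)
  extend G b = record
    { X⊆factors = λ { (here refl) → vertex∈ ; (there x∈) → X⊆factors G x∈ }
    ; X≄        = ¬Any⇒All¬ _ vertex∉X ∷ X≄ G
    ; F⊆factors = λ { (here refl) → edge∈ ; (there e∈) → F⊆factors G e∈ }
    -- Edges of `F` lie inside `X`; the boundary edge does not, so it is equivalent to none of them.
    ; F≄        = All.tabulate (λ f∈ e≃f → outside (Inside-≃ e≃f (F-inside G f∈))) ∷ F≄ G
    ; F-nonpal  = λ { (here refl) → nonpal ; (there e∈) → F-nonpal G e∈ }
    ; F-inside  = λ { (here refl) → inside ; (there e∈) → Inside-∷ (F-inside G e∈) }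
    }
    where open Boundary b

  -- Adding a boundary edge with its new endpoint preserves |X| − |F|, and connectedness lets this
  -- continue until X contains every vertex, where the bound is a comparison of counts.
  subgraph-bound : ∀ {n X F x} → x ∈ X → Subgraph n X F →
    length (factors n) + 𝓟 n + 𝓟 (suc n) + 2 * length F ≤ length (factors (suc n)) + 2 * length X
  subgraph-bound {n} x∈X G = grow (suc (length (factors n))) x∈X G (m≤m+n _ _)
    where
    -- `d` bounds the steps still possible. At 0 the list `X` would be longer than `factors n`,
    -- although it consists of distinct factors.
    grow : ∀ d {X F x} → x ∈ X → Subgraph n X F → suc (length (factors n)) ≤ d + length X →
      length (factors n) + 𝓟 n + 𝓟 (suc n) + 2 * length F ≤ length (factors (suc n)) + 2 * length X
    grow zero x∈X G bound = contradiction bound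
      (<⇒≱ (s≤s (length-⊆ (AllPairs.map (λ x≄y x≡y → x≄y (inj₁ x≡y)) (X≄ G)) (X⊆factors G))))
    grow (suc d) {X} {F} x∈X G bound
      with All.all? (λ v → Any.any? (v ≃?_) X) (factors n)
    ... | yes covered = begin
      length (factors n) + 𝓟 n + 𝓟 (suc n) + 2 * length F
        ≡⟨ shuffle (length (factors n) + 𝓟 n) (𝓟 (suc n)) (2 * length F) ⟩
      2 * length F + 𝓟 (suc n) + (length (factors n) + 𝓟 n)
        ≤⟨ +-mono-≤ (packing-bound (F≄ G) (F⊆factors G) (F-nonpal G) factors-reverse (factors! (suc n)))
                    (covering-bound (factors! n) (All.lookup covered)) ⟩
      length (factors (suc n)) + 2 * length X ∎
      where
      open ≤-Reasoning
      shuffle : ∀ a b c → a + b + c ≡ c + b + a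
      shuffle = solve-∀
    ... | no ¬covered with find (¬All⇒Any¬ (λ v → Any.any? (v ≃?_) X) (factors n) ¬covered)
    ... | v , v∈ , v∉X = +-cancelʳ-≤ 2 _ _ (begin
      length (factors n) + 𝓟 n + 𝓟 (suc n) + 2 * length F + 2
        ≡⟨ shift (length (factors n) + 𝓟 n + 𝓟 (suc n)) (length F) ⟩
      length (factors n) + 𝓟 n + 𝓟 (suc n) + 2 * suc (length F)
        ≤⟨ grow d (there x∈X) (extend G b)
             (subst (suc (length (factors n)) ≤_) (sym (+-suc d (length X))) bound) ⟩
      length (factors (suc n)) + 2 * suc (length X)
        ≡⟨ shift (length (factors (suc n))) (length X) ⟨
      length (factors (suc n)) + 2 * length X + 2 ∎)
      where
      open ≤-Reasoning
      b : Boundary n X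
      b = boundary x∈X (X⊆factors G x∈X) v∈ v∉X
      shift : ∀ a b → a + 2 * b + 2 ≡ a + 2 * suc b
      shift = solve-∀

  -- Growth starts here from a single vertex and no edges.
  palindrome-bound : ∀ n → length (factors n) + 𝓟 n + 𝓟 (suc n) ≤ length (factors (suc n)) + 2
  palindrome-bound n = subst (_≤ length (factors (suc n)) + 2) (+-identityʳ _)
    (subgraph-bound {X = [ factorAt u 0 n ]} {F = []} (here refl) record
      { X⊆factors = λ { (here refl) → factorAt-∈-factors 0 n }
      ; X≄        = [] ∷ []
      ; F⊆factors = λ ()
      ; F≄        = []
      ; F-nonpal  = λ ()
      ; F-inside  = λ ()
      })

-- Vanishing of the bilateral order as an equation of natural numbers.

order-rearranged : ∀ b r l → pos b ℤ.- pos r ℤ.- pos l ℤ.+ 1ℤ ≡ pos (suc b) ℤ.- pos (r + l)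
order-rearranged b r l = rearrange (pos b) (pos r) (pos l)
  where
  rearrange : ∀ b r l → b ℤ.- r ℤ.- l ℤ.+ 1ℤ ≡ 1ℤ ℤ.+ b ℤ.- (r ℤ.+ l)
  rearrange = ℤSolver.solve-∀

order-zero⁺ : ∀ b r l → suc b ≡ r + l → 0ℤ ≡ pos b ℤ.- pos r ℤ.- pos l ℤ.+ 1ℤ
order-zero⁺ b r l eq =
  sym (trans (order-rearranged b r l) (ℤ.i≡j⇒i-j≡0 (cong pos eq)))

order-zero⁻ : ∀ b r l → 0ℤ ≡ pos b ℤ.- pos r ℤ.- pos l ℤ.+ 1ℤ → suc b ≡ r + l
order-zero⁻ b r l eq =
  ℤ.+-injective (ℤ.i-j≡0⇒i≡j _ _ (trans (sym (order-rearranged b r l)) (sym eq)))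

-- Extensions of a factor when the complexity is `K * n + 1`.

module _ {A : Set} (_≟_ : DecidableEquality A)
  (letters : List A) (letters! : Unique letters) (∈-letters : ∀ a → a ∈ letters)
  (u : ℕ → A) (reversal : ClosedUnderReversal u)
  (K : ℕ) (complexity : ∀ n → Complexity u n (K * n + 1))
  where

  open Reversal _≟_
  open Language _≟_ u reversal (λ n → K * n + 1) complexity

  lefts rights : List A → List A
  lefts w  = filter (λ a → 𝓛? (a ∷ w)) letters
  rights w = filter (λ a → 𝓛? (w ∷ʳ a)) letters

  biextensions : List A → List (List A)
  biextensions w = filter (λ v → inner v ≟ʷ w) (factors (2 + length w))

  lefts! : ∀ w → Unique (lefts w)
  lefts! w = Unique.filter⁺ _ letters!

  rights! : ∀ w → Unique (rights w)
  rights! w = Unique.filter⁺ _ letters!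

  biextensions! : ∀ w → Unique (biextensions w)
  biextensions! w = Unique.filter⁺ _ (factors! _)

  ∈-lefts : ∀ {w a} → a ∈ lefts w ⇔ 𝓛 u (a ∷ w)
  ∈-lefts {w} = mk⇔ (proj₂ ∘ ∈-filter⁻ (λ a → 𝓛? (a ∷ w)) {xs = letters}) (∈-filter⁺ _ (∈-letters _))

  ∈-rights : ∀ {w a} → a ∈ rights w ⇔ 𝓛 u (w ∷ʳ a)
  ∈-rights {w} = mk⇔ (proj₂ ∘ ∈-filter⁻ (λ a → 𝓛? (w ∷ʳ a)) {xs = letters}) (∈-filter⁺ _ (∈-letters _))

  length-∷-∷ʳ : ∀ a w (b : A) → length (a ∷ (w ∷ʳ b)) ≡ 2 + length w
  length-∷-∷ʳ a w b = cong suc (length-∷ʳ w b)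

  ∈-biextensions⁺ : ∀ {a w b} → 𝓛 u (a ∷ (w ∷ʳ b)) → a ∷ (w ∷ʳ b) ∈ biextensions w
  ∈-biextensions⁺ {a} {w} {b} awb∈𝓛 =
    ∈-filter⁺ _ (∈-factors⁺ (length-∷-∷ʳ a w b) awb∈𝓛) (inner-∷-∷ʳ a w b)

  ∈-biextensions⁻ : ∀ {w v} → v ∈ biextensions w → Bext u w v
  ∈-biextensions⁻ {w} {v} v∈
    with ∈-filter⁻ (λ v → inner v ≟ʷ w) {xs = factors (2 + length w)} v∈
  ... | v∈factors , inner-v≡w with ∈-factors⁻ v∈factors
  ... | |v| , v∈𝓛 with length-2+⇒∷-∷ʳ v |v|
  ... | a , w′ , b , refl , _ with trans (sym (inner-∷-∷ʳ a w′ b)) inner-v≡w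
  ... | refl = v∈𝓛 , a , b , refl

  Lext-size : ∀ w → HasSize (Lext u w) (length (lefts w))
  Lext-size w = lefts w , lefts! w , (λ _ → ∈-lefts) , refl

  Rext-size : ∀ w → HasSize (Rext u w) (length (rights w))
  Rext-size w = rights w , rights! w , (λ _ → ∈-rights) , refl

  Bext-size : ∀ w → HasSize (Bext u w) (length (biextensions w))
  Bext-size w = biextensions w , biextensions! w ,
    (λ _ → mk⇔ ∈-biextensions⁻ λ { (v∈𝓛 , a , b , refl) → ∈-biextensions⁺ v∈𝓛 }) , refl

  palindrome-left⇒right : ∀ {w a} → Palindrome w → 𝓛 u (a ∷ w) → 𝓛 u (w ∷ʳ a)
  palindrome-left⇒right {w} {a} w-pal aw∈𝓛 =
    subst (𝓛 u) (trans (unfold-reverse a w) (cong (_∷ʳ a) (sym w-pal))) (reversal _ aw∈𝓛)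

  palindrome-right⇒left : ∀ {w a} → Palindrome w → 𝓛 u (w ∷ʳ a) → 𝓛 u (a ∷ w)
  palindrome-right⇒left {w} {a} w-pal wa∈𝓛 =
    subst (𝓛 u) (trans (reverse-∷ʳ w a) (cong (a ∷_) (sym w-pal))) (reversal _ wa∈𝓛)

  palindrome-lefts≡rights : ∀ {w} → Palindrome w → length (lefts w) ≡ length (rights w)
  palindrome-lefts≡rights {w} w-pal = ≤-antisym
    (length-⊆ (lefts! w) (from ∈-rights ∘ palindrome-left⇒right w-pal ∘ to ∈-lefts))
    (length-⊆ (rights! w) (from ∈-lefts ∘ palindrome-right⇒left w-pal ∘ to ∈-rights))

  biextendable : ∀ {w} → 𝓛 u w → ∃₂ λ a b → 𝓛 u (a ∷ (w ∷ʳ b))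
  biextendable w∈𝓛 with right-extendable w∈𝓛
  ... | b , wb∈𝓛 with left-extendable wb∈𝓛
  ... | a , awb∈𝓛 = a , b , awb∈𝓛

  length-factors-suc : ∀ n → length (factors (suc n)) ≡ length (factors n) + K
  length-factors-suc n = begin
    length (factors (suc n)) ≡⟨ length-factors (suc n) ⟩
    K * suc n + 1            ≡⟨ expand K n ⟩
    K * n + 1 + K            ≡⟨ cong (_+ K) (length-factors n) ⟨
    length (factors n) + K   ∎
    where
    open ≡-Reasoning
    expand : ∀ k n → k * suc n + 1 ≡ k * n + 1 + k
    expand = solve-∀

  -- Counting palindromes when each has a palindromic extension.

  PalindromesExtend : Set
  PalindromesExtend = ∀ {w} → 𝓛 u w → Palindrome w → ∃[ a ] 𝓛 u (a ∷ (w ∷ʳ a))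

  ∷-∷ʳ-palindrome : ∀ {w} (a : A) → Palindrome w → Palindrome (a ∷ (w ∷ʳ a))
  ∷-∷ʳ-palindrome {w} a w-pal =
    trans (cong (λ v → a ∷ (v ∷ʳ a)) w-pal) (sym (reverse-∷-∷ʳ a w a))

  ∈-palindromes-∷-∷ʳ : ∀ {w a} → Palindrome w → 𝓛 u (a ∷ (w ∷ʳ a)) →
    a ∷ (w ∷ʳ a) ∈ palindromes (2 + length w)
  ∈-palindromes-∷-∷ʳ {w} {a} w-pal awa∈𝓛 =
    ∈-palindromes⁺ (length-∷-∷ʳ a w a) awa∈𝓛 (∷-∷ʳ-palindrome a w-pal)

  -- The image of `vs` under `inner` contains all palindromes of length `n`.
  𝓟-≤-extensions : ∀ {n vs} → (∀ {w} → w ∈ palindromes n → ∃[ v ] v ∈ vs × w ≡ inner v) →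
    𝓟 n ≤ length vs
  𝓟-≤-extensions {n} {vs} extension = subst (𝓟 n ≤_) (length-map inner vs)
    (length-⊆ (Unique.filter⁺ _ (factors! n)) λ w∈ →
      let _ , v∈ , eq = extension w∈ in subst (_∈ map inner vs) (sym eq) (∈-map⁺ inner v∈))

  module _ (extend-palindrome : PalindromesExtend) where

    𝓟-mono : ∀ n → 𝓟 n ≤ 𝓟 (2 + n)
    𝓟-mono n = 𝓟-≤-extensions extension
      where
      extension : ∀ {w} → w ∈ palindromes n → ∃[ v ] v ∈ palindromes (2 + n) × w ≡ inner v
      extension {w} w∈ with ∈-palindromes⁻ w∈
      ... | refl , w∈𝓛 , w-pal with extend-palindrome w∈𝓛 w-pal
      ... | a , awa∈𝓛 = _ , ∈-palindromes-∷-∷ʳ w-pal awa∈𝓛 , sym (inner-∷-∷ʳ a w a)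

    -- At length 0 the empty word and the `K + 1` factors of length 1 are counted, all palindromes;
    -- each further step replaces P(n) by P(n + 2), which is no smaller.
    𝓟-lower-bound : ∀ n → K + 2 ≤ 𝓟 n + 𝓟 (suc n)
    𝓟-lower-bound zero = begin
      K + 2                         ≡⟨ rearrange K ⟩
      1 + (K * 1 + 1)               ≡⟨ cong suc (length-factors 1) ⟨
      1 + length (factors 1)        ≤⟨ +-mono-≤ 1≤𝓟0 (length-⊆ (factors! 1) letter-palindrome) ⟩
      𝓟 0 + 𝓟 1                     ∎
      where
      open ≤-Reasoning
      rearrange : ∀ k → k + 2 ≡ 1 + (k * 1 + 1)
      rearrange = solve-∀
      1≤𝓟0 : 1 ≤ 𝓟 0
      1≤𝓟0 = ∈-length (∈-palindromes⁺ {w = []} refl (0 , refl) refl)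
      letter-palindrome : ∀ {w} → w ∈ factors 1 → w ∈ palindromes 1
      letter-palindrome {w} w∈ with ∈-factors⁻ w∈
      letter-palindrome {_ ∷ []} w∈ | |w| , w∈𝓛 = ∈-palindromes⁺ |w| w∈𝓛 refl
    𝓟-lower-bound (suc n) = begin
      K + 2                   ≤⟨ 𝓟-lower-bound n ⟩
      𝓟 n + 𝓟 (suc n)         ≤⟨ +-monoˡ-≤ _ (𝓟-mono n) ⟩
      𝓟 (2 + n) + 𝓟 (suc n)   ≡⟨ +-comm (𝓟 (2 + n)) _ ⟩
      𝓟 (suc n) + 𝓟 (2 + n)   ∎
      where open ≤-Reasoning

    𝓟-upper-bound : ∀ n → 𝓟 n + 𝓟 (suc n) ≤ K + 2
    𝓟-upper-bound n = +-cancelˡ-≤ (length (factors n)) _ _ (begin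
      length (factors n) + (𝓟 n + 𝓟 (suc n)) ≡⟨ +-assoc (length (factors n)) _ _ ⟨
      length (factors n) + 𝓟 n + 𝓟 (suc n)   ≤⟨ palindrome-bound n ⟩
      length (factors (suc n)) + 2           ≡⟨ cong (_+ 2) (length-factors-suc n) ⟩
      length (factors n) + K + 2             ≡⟨ +-assoc (length (factors n)) K 2 ⟩
      length (factors n) + (K + 2)           ∎)
      where open ≤-Reasoning

    -- If `w` had two palindromic extensions, one could be discarded and the rest would still cover
    -- all palindromes of length n. Then P(n) < P(n + 2), and the lower bound at n would exceed the
    -- upper bound at n + 1.
    palindromic-extension-unique : ∀ {w a c} → Palindrome w →
      𝓛 u (a ∷ (w ∷ʳ a)) → 𝓛 u (c ∷ (w ∷ʳ c)) → a ≡ c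
    palindromic-extension-unique {w} {a} {c} w-pal awa∈𝓛 cwc∈𝓛 with a ≟ c
    ... | yes a≡c = a≡c
    ... | no  a≢c = contradiction (𝓟-upper-bound (suc n)) (<⇒≱ (begin-strict
      K + 2                 ≤⟨ 𝓟-lower-bound n ⟩
      𝓟 n + 𝓟 (suc n)       <⟨ +-monoˡ-< _ 𝓟n<𝓟2+n ⟩
      𝓟 (2 + n) + 𝓟 (suc n) ≡⟨ +-comm (𝓟 (2 + n)) _ ⟩
      𝓟 (suc n) + 𝓟 (2 + n) ∎))
      where
      open ≤-Reasoning
      n : ℕ
      n = length w
      others : List (List A)
      others = filter (λ v → ¬? (v ≟ʷ (c ∷ (w ∷ʳ c)))) (palindromes (2 + n))
      extension : ∀ {x} → x ∈ palindromes n → ∃[ v ] v ∈ others × x ≡ inner v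
      extension {x} x∈ with ∈-palindromes⁻ x∈
      ... | |x| , x∈𝓛 , x-pal with x ≟ʷ w
      ... | yes refl = _ ,
        ∈-filter⁺ _ (∈-palindromes-∷-∷ʳ w-pal awa∈𝓛) (a≢c ∘ ∷-injectiveˡ) , sym (inner-∷-∷ʳ a w a)
      ... | no x≢w with extend-palindrome x∈𝓛 x-pal
      ... | d , dxd∈𝓛 = d ∷ (x ∷ʳ d) ,
        ∈-filter⁺ _ (subst (λ m → d ∷ (x ∷ʳ d) ∈ palindromes (2 + m)) |x| (∈-palindromes-∷-∷ʳ x-pal dxd∈𝓛))
          (x≢w ∘ proj₁ ∘ proj₂ ∘ ∷-∷ʳ-injective x w) ,
        sym (inner-∷-∷ʳ d x d)
      𝓟n<𝓟2+n : 𝓟 n < 𝓟 (2 + n)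
      𝓟n<𝓟2+n = ≤-<-trans (𝓟-≤-extensions extension)
        (filter-notAll _ _ (lose (∈-palindromes-∷-∷ʳ w-pal cwc∈𝓛) (λ ¬p → ¬p refl)))

    -- Since P(n) + P(n + 1) is at least `K + 2`, the inequality of `subgraph-bound` leaves room for
    -- at most |X| - 1 edges. Subgraphs of the quotient tree are forests, connected or not.
    forest-bound : ∀ {n X F x} → x ∈ X → Subgraph n X F → suc (length F) ≤ length X
    forest-bound {n} {X} {F} x∈X G = *-cancelˡ-≤ 2 (+-cancelˡ-≤ (length (factors n) + K) _ _ (begin
      length (factors n) + K + 2 * suc (length F)
        ≡⟨ rearrange (length (factors n)) K (length F) ⟩
      length (factors n) + (K + 2) + 2 * length F
        ≤⟨ +-monoˡ-≤ _ (+-monoʳ-≤ (length (factors n)) (𝓟-lower-bound n)) ⟩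
      length (factors n) + (𝓟 n + 𝓟 (suc n)) + 2 * length F
        ≡⟨ cong (_+ 2 * length F) (+-assoc (length (factors n)) _ _) ⟨
      length (factors n) + 𝓟 n + 𝓟 (suc n) + 2 * length F
        ≤⟨ subgraph-bound x∈X G ⟩
      length (factors (suc n)) + 2 * length X
        ≡⟨ cong (_+ 2 * length X) (length-factors-suc n) ⟩
      length (factors n) + K + 2 * length X ∎))
      where
      open ≤-Reasoning
      rearrange : ∀ a k f → a + k + 2 * suc f ≡ a + (k + 2) + 2 * f
      rearrange = solve-∀

  -- The extensions of a word as a subgraph of the quotient.

  left-vertices right-vertices : List A → List (List A)
  left-vertices w  = map (_∷ w) (lefts w)
  right-vertices w = map (w ∷ʳ_) (rights w)

  left-vertices≄ : ∀ w → AllPairs _≄_ (left-vertices w)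
  left-vertices≄ w = AllPairs.map⁺ (AllPairs.map
    (λ a≢b aw≃bw → a≢b (∷-↭-injective w (≃⇒↭ aw≃bw))) (lefts! w))

  right-vertices≄ : ∀ w → AllPairs _≄_ (right-vertices w)
  right-vertices≄ w = AllPairs.map⁺ (AllPairs.map
    (λ {a} {b} a≢b wa≃wb → a≢b (∷-↭-injective w
      (↭-trans (∷↭∷ʳ a w) (↭-trans (≃⇒↭ wa≃wb) (↭-sym (∷↭∷ʳ b w)))))) (rights! w))

  left-vertices∈ : ∀ {w x} → x ∈ left-vertices w → x ∈ factors (suc (length w))
  left-vertices∈ x∈ with ∈-map⁻ _ x∈
  ... | a , a∈ , refl = ∈-factors⁺ refl (to ∈-lefts a∈)

  right-vertices∈ : ∀ {w x} → x ∈ right-vertices w → x ∈ factors (suc (length w))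
  right-vertices∈ {w} x∈ with ∈-map⁻ _ x∈
  ... | a , a∈ , refl = ∈-factors⁺ (length-∷ʳ w a) (to ∈-rights a∈)

  biextensions∈ : ∀ {w v} → v ∈ biextensions w → v ∈ factors (2 + length w)
  biextensions∈ {w} = proj₁ ∘ ∈-filter⁻ (λ v → inner v ≟ʷ w)

  left-vertex : ∀ {a w b} → 𝓛 u (a ∷ (w ∷ʳ b)) → a ∷ w ∈ left-vertices w
  left-vertex awb∈𝓛 = ∈-map⁺ _ (from ∈-lefts (𝓛-∷ʳ⁻ awb∈𝓛))

  right-vertex : ∀ {a w b} → 𝓛 u (a ∷ (w ∷ʳ b)) → w ∷ʳ b ∈ right-vertices w
  right-vertex awb∈𝓛 = ∈-map⁺ _ (from ∈-rights (𝓛-∷⁻ awb∈𝓛))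

  -- A bipartite graph in which `awb` joins `aw` to `wb`. Reversal identifies no two of its edges
  -- and no left vertex with a right one: either would force `w` to be a palindrome.
  nonpalindrome-subgraph : ∀ {w} → ¬ Palindrome w →
    Subgraph (suc (length w)) (left-vertices w ++ right-vertices w) (biextensions w)
  nonpalindrome-subgraph {w} w-nonpal = record
    { X⊆factors = λ x∈ → Sum.[ left-vertices∈ , right-vertices∈ ]′ (∈-++⁻ (left-vertices w) x∈)
    ; X≄        = AllPairs.++⁺ (left-vertices≄ w) (right-vertices≄ w)
                    (All.tabulate λ x∈ → All.tabulate λ y∈ → left≄right x∈ y∈)
    ; F⊆factors = biextensions∈
    ; F≄        = Unique⇒AllPairs (biextensions! w) biextensions≄
    ; F-nonpal  = λ v∈ v-pal → biextension≢reverse v∈ v∈ v-pal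
    ; F-inside  = inside
    }
    where
    left≄right : ∀ {x y} → x ∈ left-vertices w → y ∈ right-vertices w → x ≄ y
    left≄right x∈ y∈ x≃y with ∈-map⁻ _ x∈ | ∈-map⁻ _ y∈
    left≄right x∈ y∈ (inj₁ aw≡wb) | a , _ , refl | b , _ , refl =
      w-nonpal (∷≡∷ʳ⇒palindrome w aw≡wb)
    left≄right x∈ y∈ (inj₂ aw≡bw̄) | a , _ , refl | b , _ , refl =
      w-nonpal (∷-injectiveʳ (trans aw≡bw̄ (reverse-∷ʳ w b)))
    biextension≢reverse : ∀ {v v′} → v ∈ biextensions w → v′ ∈ biextensions w → v ≢ reverse v′
    biextension≢reverse v∈ v′∈ v≡v̄′ with ∈-biextensions⁻ v∈ | ∈-biextensions⁻ v′∈
    ... | _ , a , b , refl | _ , c , d , refl = w-nonpal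
      (proj₁ (proj₂ (∷-∷ʳ-injective w (reverse w) (trans v≡v̄′ (reverse-∷-∷ʳ c w d)))))
    biextensions≄ : ∀ {v v′} → v ∈ biextensions w → v′ ∈ biextensions w → v ≢ v′ → v ≄ v′
    biextensions≄ v∈ v′∈ v≢v′ (inj₁ v≡v′) = v≢v′ v≡v′
    biextensions≄ v∈ v′∈ v≢v′ (inj₂ v≡v̄′) = biextension≢reverse v∈ v′∈ v≡v̄′
    inside : ∀ {v} → v ∈ biextensions w → Inside (left-vertices w ++ right-vertices w) v
    inside v∈ with ∈-biextensions⁻ v∈
    ... | awb∈𝓛 , a , b , refl = Inside-edge refl
      (lose (∈-++⁺ʳ (left-vertices w) (right-vertex awb∈𝓛)) ≃-refl)
      (lose (∈-++⁺ˡ (left-vertex awb∈𝓛)) ≃-refl)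

  asymmetric-biextensions : List A → List (List A)
  asymmetric-biextensions w = filter (λ v → ¬? (palindrome? v)) (biextensions w)

  -- Now `wb` is the reversal of `bw`, so the left vertices suffice; `awb` and `bwa` are the same
  -- edge, and the extensions `awa` are loops.
  palindrome-subgraph : ∀ {w} → Palindrome w →
    Subgraph (suc (length w)) (left-vertices w) (representatives (asymmetric-biextensions w))
  palindrome-subgraph {w} w-pal = record
    { X⊆factors = left-vertices∈
    ; X≄        = left-vertices≄ w
    ; F⊆factors = biextensions∈ ∘ proj₁ ∘ representative⁻
    ; F≄        = AllPairs-deduplicate _≃?_ (asymmetric-biextensions w)
    ; F-nonpal  = proj₂ ∘ representative⁻
    ; F-inside  = inside ∘ proj₁ ∘ representative⁻
    }
    where
    representative⁻ : ∀ {v} → v ∈ representatives (asymmetric-biextensions w) →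
      v ∈ biextensions w × ¬ Palindrome v
    representative⁻ v∈ = ∈-filter⁻ (λ v → ¬? (palindrome? v))
      (∈-deduplicate⁻ _≃?_ (asymmetric-biextensions w) v∈)
    inside : ∀ {v} → v ∈ biextensions w → Inside (left-vertices w) v
    inside v∈ with ∈-biextensions⁻ v∈
    ... | awb∈𝓛 , a , b , refl = Inside-edge refl
      (lose (∈-map⁺ _ (from ∈-lefts (palindrome-right⇒left w-pal (𝓛-∷⁻ awb∈𝓛))))
        (inj₂ (trans (cong (_∷ʳ b) w-pal) (sym (unfold-reverse b w)))))
      (lose (left-vertex awb∈𝓛) ≃-refl)

  -- From unique palindromic extensions to ordinary bispecial factors.

  unique⇒extend : UniquePalindromicExtensions u → PalindromesExtend
  unique⇒extend unique w∈𝓛 w-pal with unique _ w∈𝓛 w-pal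
  ... | _ , (awa∈𝓛 , a , refl) , _ = a , awa∈𝓛

  -- For a nonpalindrome this is the forest bound itself. For a palindrome each edge of the forest
  -- accounts for at most two extensions, and one more is the palindromic one: # Bext(w) ≤ 1 + 2 (#
  -- Lext(w) - 1).
  bilateral-bound : UniquePalindromicExtensions u → ∀ {w} → 𝓛 u w →
    suc (length (biextensions w)) ≤ length (left-vertices w) + length (right-vertices w)
  bilateral-bound unique {w} w∈𝓛 with palindrome? w
  ... | no w-nonpal = subst (suc (length (biextensions w)) ≤_) (length-++ (left-vertices w))
    (forest-bound (unique⇒extend unique) (∈-++⁺ˡ (left-vertex (proj₂ (proj₂ (biextendable w∈𝓛)))))
      (nonpalindrome-subgraph w-nonpal))
  ... | yes w-pal with unique w w∈𝓛 w-pal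
  ... | v , (v∈𝓛 , _) , v-unique = begin
    suc (length (biextensions w))              ≤⟨ s≤s (length-⊆ (biextensions! w) biextensions⊆) ⟩
    2 + length nonpals                         ≤⟨ s≤s (s≤s (m≤m+n _ _)) ⟩
    2 + (length nonpals + length (filter palindrome? nonpals))
      ≤⟨ s≤s (s≤s (covering-bound (Unique.filter⁺ _ (biextensions! w)) ∈-representatives)) ⟩
    2 + 2 * length (representatives nonpals) ≡⟨ double (length (representatives nonpals)) ⟩
    suc (length (representatives nonpals)) + suc (length (representatives nonpals))
      ≤⟨ +-mono-≤ edges<vertices edges<vertices ⟩
    length (left-vertices w) + length (left-vertices w)
      ≡⟨ cong (length (left-vertices w) +_) left≡right ⟩
    length (left-vertices w) + length (right-vertices w) ∎
    where
    open ≤-Reasoning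
    nonpals : List (List A)
    nonpals = asymmetric-biextensions w
    double : ∀ n → 2 + 2 * n ≡ suc n + suc n
    double = solve-∀
    edges<vertices : suc (length (representatives nonpals)) ≤ length (left-vertices w)
    edges<vertices = forest-bound (unique⇒extend unique)
      (left-vertex (proj₂ (proj₂ (biextendable w∈𝓛)))) (palindrome-subgraph w-pal)
    left≡right : length (left-vertices w) ≡ length (right-vertices w)
    left≡right = trans (length-map _ (lefts w))
      (trans (palindrome-lefts≡rights w-pal) (sym (length-map _ (rights w))))
    biextensions⊆ : ∀ {x} → x ∈ biextensions w → x ∈ v ∷ nonpals
    biextensions⊆ {x} x∈ with palindrome? x
    ... | no x-nonpal = there (∈-filter⁺ _ x∈ x-nonpal)
    ... | yes x-pal with ∈-biextensions⁻ x∈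
    ... | x∈𝓛 , a , b , refl with proj₁ (∷-∷ʳ-injective w (reverse w) (trans x-pal (reverse-∷-∷ʳ a w b)))
    ... | refl = here (sym (v-unique (x∈𝓛 , a , refl)))

  -- A word of length n + 1 extends only its own suffix of length n to the left, so no word is
  -- counted twice. This bound, its mirror image and the one for `biextensions` all point the way
  -- that bounds the sum of b(w) from below.
  Σ-left-vertices : ∀ n → sum (map (length ∘ left-vertices) (factors n)) ≤ length (factors (suc n))
  Σ-left-vertices n = subst (_≤ length (factors (suc n))) (length-concatMap left-vertices (factors n))
    (length-⊆ (Unique-concatMap left-vertices (factors! n)
      (λ w → Unique.map⁺ ∷-injectiveˡ (lefts! w)) disjoint) concat⊆)
    where
    disjoint : ∀ {w w′ v} → v ∈ left-vertices w → v ∈ left-vertices w′ → w ≡ w′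
    disjoint v∈ v∈′ with ∈-map⁻ _ v∈ | ∈-map⁻ _ v∈′
    ... | _ , _ , refl | _ , _ , eq = ∷-injectiveʳ eq
    concat⊆ : ∀ {v} → v ∈ concatMap left-vertices (factors n) → v ∈ factors (suc n)
    concat⊆ v∈ with find (∈-concatMap⁻ left-vertices {xs = factors n} v∈)
    ... | w , w∈ , v∈w with refl ← proj₁ (∈-factors⁻ w∈) = left-vertices∈ v∈w

  Σ-right-vertices : ∀ n → sum (map (length ∘ right-vertices) (factors n)) ≤ length (factors (suc n))
  Σ-right-vertices n = subst (_≤ length (factors (suc n))) (length-concatMap right-vertices (factors n))
    (length-⊆ (Unique-concatMap right-vertices (factors! n)
      (λ w → Unique.map⁺ (∷ʳ-injectiveʳ w w) (rights! w)) disjoint) concat⊆)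
    where
    disjoint : ∀ {w w′ v} → v ∈ right-vertices w → v ∈ right-vertices w′ → w ≡ w′
    disjoint {w} {w′} v∈ v∈′ with ∈-map⁻ _ v∈ | ∈-map⁻ _ v∈′
    ... | _ , _ , refl | _ , _ , eq = ∷ʳ-injectiveˡ w w′ eq
    concat⊆ : ∀ {v} → v ∈ concatMap right-vertices (factors n) → v ∈ factors (suc n)
    concat⊆ v∈ with find (∈-concatMap⁻ right-vertices {xs = factors n} v∈)
    ... | w , w∈ , v∈w with refl ← proj₁ (∈-factors⁻ w∈) = right-vertices∈ v∈w

  Σ-biextensions : ∀ n → length (factors (2 + n)) ≤ sum (map (length ∘ biextensions) (factors n))
  Σ-biextensions n = subst (length (factors (2 + n)) ≤_) (length-concatMap biextensions (factors n))
    (length-⊆ (factors! (2 + n)) ⊆concat)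
    where
    ⊆concat : ∀ {v} → v ∈ factors (2 + n) → v ∈ concatMap biextensions (factors n)
    ⊆concat {v} v∈ with ∈-factors⁻ v∈
    ... | |v| , v∈𝓛 with length-2+⇒∷-∷ʳ v |v|
    ... | a , w , b , refl , |w| = ∈-concatMap⁺ biextensions
      (lose (∈-factors⁺ |w| (𝓛-∷ʳ⁻ (𝓛-∷⁻ v∈𝓛))) (∈-biextensions⁺ v∈𝓛))

  -- The second difference of the complexity vanishes, so the bilateral orders of the factors of a
  -- given length sum to 0; as none is positive, all are 0.
  bilateral-equality : UniquePalindromicExtensions u → ∀ {w} → 𝓛 u w →
    suc (length (biextensions w)) ≡ length (lefts w) + length (rights w)
  bilateral-equality unique {w} w∈𝓛 = trans
    (sum-map-squeeze (suc ∘ length ∘ biextensions) vertices (factors n)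
      (bilateral-bound unique ∘ proj₂ ∘ ∈-factors⁻) Σ≤ (∈-factors⁺ refl w∈𝓛))
    (cong₂ _+_ (length-map _ (lefts w)) (length-map _ (rights w)))
    where
    open ≤-Reasoning
    n : ℕ
    n = length w
    vertices : List A → ℕ
    vertices v = length (left-vertices v) + length (right-vertices v)
    rearrange : ∀ c k → c + k + (c + k) ≡ c + (c + k + k)
    rearrange = solve-∀
    Σ≤ : sum (map vertices (factors n)) ≤ sum (map (suc ∘ length ∘ biextensions) (factors n))
    Σ≤ = begin
      sum (map vertices (factors n))
        ≡⟨ sum-map-+ (length ∘ left-vertices) (length ∘ right-vertices) (factors n) ⟩
      sum (map (length ∘ left-vertices) (factors n)) + sum (map (length ∘ right-vertices) (factors n))
        ≤⟨ +-mono-≤ (Σ-left-vertices n) (Σ-right-vertices n) ⟩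
      length (factors (suc n)) + length (factors (suc n))
        ≡⟨ cong₂ _+_ (length-factors-suc n) (length-factors-suc n) ⟩
      length (factors n) + K + (length (factors n) + K)
        ≡⟨ rearrange (length (factors n)) K ⟩
      length (factors n) + (length (factors n) + K + K)
        ≡⟨ cong (λ m → length (factors n) + (m + K)) (length-factors-suc n) ⟨
      length (factors n) + (length (factors (suc n)) + K)
        ≡⟨ cong (length (factors n) +_) (length-factors-suc (suc n)) ⟨
      length (factors n) + length (factors (2 + n))
        ≤⟨ +-monoʳ-≤ (length (factors n)) (Σ-biextensions n) ⟩
      length (factors n) + sum (map (length ∘ biextensions) (factors n))
        ≡⟨ cong (_+ sum (map (length ∘ biextensions) (factors n))) (sum-map-1 (factors n)) ⟨
      sum (map (λ _ → 1) (factors n)) + sum (map (length ∘ biextensions) (factors n))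
        ≡⟨ sum-map-+ (λ _ → 1) (length ∘ biextensions) (factors n) ⟨
      sum (map (suc ∘ length ∘ biextensions) (factors n)) ∎

  unique⇒ordinary : UniquePalindromicExtensions u → AllBispecialOrdinary u
  unique⇒ordinary unique w w-bispecial@(w∈𝓛 , _) = w-bispecial , _ , _ , _ ,
    Bext-size w , Rext-size w , Lext-size w ,
    order-zero⁺ (length (biextensions w)) (length (rights w)) (length (lefts w))
      (trans (bilateral-equality unique w∈𝓛) (+-comm (length (lefts w)) _))

  -- From ordinary bispecial factors to unique palindromic extensions.

  -- Without palindromic extensions, reversal acts freely on the biextensions of a palindrome w, so
  -- b(w) = # Bext − 2 # Lext + 1 is odd.
  unextendable-odd : ∀ {w} → Palindrome w → (∀ a → ¬ 𝓛 u (a ∷ (w ∷ʳ a))) →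
    suc (length (biextensions w)) ≢ length (rights w) + length (lefts w)
  unextendable-odd {w} w-pal unextendable eq =
    even≢odd (length (lefts w)) (length reps) (begin
      2 * length (lefts w)                 ≡⟨ cong (length (lefts w) +_) (+-identityʳ _) ⟩
      length (lefts w) + length (lefts w)  ≡⟨ cong (_+ length (lefts w)) (palindrome-lefts≡rights w-pal) ⟩
      length (rights w) + length (lefts w) ≡⟨ eq ⟨
      suc (length (biextensions w))        ≡⟨ cong suc even ⟩
      suc (2 * length reps)                ∎)
    where
    open ≡-Reasoning
    reps : List (List A)
    reps = representatives (biextensions w)
    nonpal : ∀ {v} → v ∈ biextensions w → ¬ Palindrome v
    nonpal v∈ v-pal with ∈-biextensions⁻ v∈
    ... | awb∈𝓛 , a , b , refl with proj₁ (∷-∷ʳ-injective w (reverse w) (trans v-pal (reverse-∷-∷ʳ a w b)))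
    ... | refl = unextendable a awb∈𝓛
    closed : ∀ {v} → v ∈ biextensions w → reverse v ∈ biextensions w
    closed v∈ with ∈-biextensions⁻ v∈
    ... | awb∈𝓛 , a , b , refl = subst (_∈ biextensions w) (sym reverse-awb)
      (∈-biextensions⁺ (subst (𝓛 u) reverse-awb (reversal _ awb∈𝓛)))
      where
      reverse-awb : reverse (a ∷ (w ∷ʳ b)) ≡ b ∷ (w ∷ʳ a)
      reverse-awb = trans (reverse-∷-∷ʳ a w b) (cong (λ v → b ∷ (v ∷ʳ a)) (sym w-pal))
    representative⁻ : ∀ {v} → v ∈ reps → v ∈ biextensions w
    representative⁻ = ∈-deduplicate⁻ _≃?_ (biextensions w)
    -- No biextension is a palindrome, so covering and packing squeeze the count: every class has
    -- exactly two elements.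
    even : length (biextensions w) ≡ 2 * length reps
    even = ≤-antisym
      (≤-trans (m≤m+n _ _) (covering-bound (biextensions! w) ∈-representatives))
      (≤-trans (m≤m+n _ _) (packing-bound (AllPairs-deduplicate _≃?_ (biextensions w))
        representative⁻ (nonpal ∘ representative⁻) closed (biextensions! w)))

  -- If `w` has a single left extension, any `awb` is already palindromic: reversing `wb` makes `b`
  -- a left extension too, whence `a` and `b` coincide. Otherwise `w` is bispecial and parity
  -- decides.
  ordinary⇒extend : AllBispecialOrdinary u → PalindromesExtend
  ordinary⇒extend ordinary {w} w∈𝓛 w-pal with Any.any? (λ a → 𝓛? (a ∷ (w ∷ʳ a))) letters
  ... | yes extendable = let a , _ , awa∈𝓛 = find extendable in a , awa∈𝓛
  ... | no ¬extendable with 2 ≤? length (lefts w)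
  ...   | no ≱2 with biextendable w∈𝓛
  ...     | a , b , awb∈𝓛 with length≤1⇒≡ (from ∈-lefts (𝓛-∷ʳ⁻ awb∈𝓛))
              (from ∈-lefts (palindrome-right⇒left w-pal (𝓛-∷⁻ awb∈𝓛))) (s≤s⁻¹ (≰⇒> ≱2))
  ...       | refl = a , awb∈𝓛
  ordinary⇒extend ordinary {w} w∈𝓛 w-pal | no ¬extendable | yes ≥2
    with ordinary w (w∈𝓛 , (_ , Lext-size w , ≥2) ,
      (_ , Rext-size w , subst (2 ≤_) (palindrome-lefts≡rights w-pal) ≥2))
  ... | _ , b , r , l , b-size , r-size , l-size , b≡0
    -- The sizes inside `BilateralOrder` are only asserted to exist; they must agree with the
    -- lengths of the filtered lists.
    with refl ← HasSize-unique b-size (Bext-size w)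
       | refl ← HasSize-unique r-size (Rext-size w)
       | refl ← HasSize-unique l-size (Lext-size w) =
    contradiction (order-zero⁻ (length (biextensions w)) (length (rights w)) (length (lefts w)) b≡0)
      (unextendable-odd w-pal (λ a awa∈𝓛 → ¬extendable (lose (∈-letters a) awa∈𝓛)))

  ordinary⇒unique : AllBispecialOrdinary u → UniquePalindromicExtensions u
  ordinary⇒unique ordinary w w∈𝓛 w-pal with ordinary⇒extend ordinary w∈𝓛 w-pal
  ... | a , awa∈𝓛 = _ , (awa∈𝓛 , a , refl) , λ { (cwc∈𝓛 , c , refl) →
    cong (λ d → d ∷ (w ∷ʳ d))
      (palindromic-extension-unique (ordinary⇒extend ordinary) w-pal awa∈𝓛 cwc∈𝓛) }

theorem22 : (A : Set) (k : ℕ) → A ↔ Fin k →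
    (u : ℕ → A) → EveryLetterOccurs u →
    ClosedUnderReversal u →
    (∀ n → Complexity u n ((k ∸ 1) * n + 1)) →
    UniquePalindromicExtensions u ⇔ AllBispecialOrdinary u
theorem22 A k A↔Fin u _ reversal complexity = mk⇔
  (unique⇒ordinary _≟_ letters letters! ∈-letters u reversal (k ∸ 1) complexity)
  (ordinary⇒unique _≟_ letters letters! ∈-letters u reversal (k ∸ 1) complexity)
  where
  open Inverse A↔Fin using (strictlyInverseˡ; strictlyInverseʳ) renaming (to to index; from to letter)
  _≟_ : DecidableEquality A
  _≟_ = via-injection (↔⇒↣ A↔Fin) Fin._≟_
  letters : List A
  letters = map letter (allFin k)
  letters! : Unique letters
  letters! = Unique.map⁺
    (λ {i} {j} eq → trans (sym (strictlyInverseˡ i)) (trans (cong index eq) (strictlyInverseˡ j)))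
    (Unique.allFin⁺ k)
  ∈-letters : ∀ a → a ∈ letters
  ∈-letters a = subst (_∈ letters) (strictlyInverseʳ a) (∈-map⁺ letter (∈-allFin (index a)))
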